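{- Let $c>0$, $s\in\mathbb{N}$, and let $G$ be an $n$-vertex graph with $\alpha(G)=cn$, where $n$ is sufficiently large. If for any two maximum independent sets $I_1,I_2$ of $G$ we have $e(G[I_1\triangle I_2])\le s\cdot|I_1\triangle I_2|$, then $h(G)\le \frac{5sn}{\log n}$.
   Context: $\log$ is base $2$. $\alpha(G)$ is the independence number; $I_1\triangle I_2$ is the symmetric difference; $e(G[X])$ is the number of edges of the subgraph induced on $X$. A hitting set of $G$ is a set $T\subseteq V(G)$ meeting every maximum independent set of $G$; $h(G)$ is the minimum size of a hitting set. -}

module Defs where

open import Data.Nat using (ℕ; zero; suc; _+_; _<_; _≤_)
open import Data.Bool using (Bool; true; false; _∧_; _xor_; if_then_else_)
open import Data.Fin using (Fin; toℕ)
open import Data.Fin.Subset using (Subset; _∈_; ∣_∣; Nonempty; _∩_)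
open import Data.Vec using (zipWith; lookup)
open import Data.List using (List; allFin; map; concatMap)
open import Data.Nat.ListAction using (sum)
open import Data.Integer using (+_)
open import Data.Rational using (ℚ; _/_)
open import Data.Product using (Σ; _×_; ∃)
open import Relation.Binary.PropositionalEquality using (_≡_)
open import Relation.Nullary.Decidable using (⌊_⌋)
open import Data.Fin using (_<?_)

record Graph (n : ℕ) : Set where
  field
    adj   : Fin n → Fin n → Bool
    sym   : ∀ i j → adj i j ≡ adj j i
    irrefl : ∀ i → adj i i ≡ false
open Graph public

Independent : ∀ {n} → Graph n → Subset n → Set
Independent G S = ∀ i j → i ∈ S → j ∈ S → adj G i j ≡ false

MaxIndependent : ∀ {n} → Graph n → Subset n → Set
MaxIndependent G S = Independent G S × (∀ T → Independent G T → ∣ T ∣ ≤ ∣ S ∣)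

IndependenceNumber : ∀ {n} → Graph n → ℕ → Set
IndependenceNumber G k = Σ (Subset _) (λ S → MaxIndependent G S × ∣ S ∣ ≡ k)

_△_ : ∀ {n} → Subset n → Subset n → Subset n
A △ B = zipWith _xor_ A B

edgesIn : ∀ {n} → Graph n → Subset n → ℕ
edgesIn {n} G X =
  sum (concatMap (λ i → map (λ j →
    if ⌊ i <? j ⌋ ∧ lookup X i ∧ lookup X j ∧ adj G i j then 1 else 0)
    (allFin n)) (allFin n))

HittingSet : ∀ {n} → Graph n → Subset n → Set
HittingSet G T = ∀ I → MaxIndependent G I → Nonempty (T ∩ I)

ℕtoℚ : ℕ → ℚ
ℕtoℚ k = (+ k) / 1

{-# OPTIONS --safe #-}
-- Fix a maximum independent set I₀ and write N[v] for closed neighbourhoods.  For a maximum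
-- independent J, sparsity of I₀ △ J gives Σ_{v ∈ I₀} |N[v] ∩ J| ≤ 2s|I₀|, so for the union W of
-- j such sets, some r vertices V ⊆ I₀ have |N[V] ∩ W| ≤ 2sjr.  If N[V] ∩ W hits every maximum
-- independent set, stop; otherwise one that misses it contains at least r vertices of N[V],
-- all outside W, and is added to W.  With r about 5n / (2j log n) the union would gain
-- Σ_j r vertices, which exceeds n after about n/16 steps, so the process stops with a hitting
-- set of size at most 5sn / log n.
module Submission where

open import Defs
open import Data.Nat using (ℕ; _≤_; _*_; _^_)
open import Data.Fin.Subset using (Subset; ∣_∣)
open import Data.Rational using (ℚ; Positive) renaming (_*_ to _*ℚ_)
open import Data.Product using (Σ; _×_; ∃-syntax)
open import Relation.Binary.PropositionalEquality using (_≡_)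

open import Data.Bool using (Bool; true; false; _∧_; _∨_; not; _xor_; if_then_else_)
open import Data.Bool.Properties using (∧-assoc; ∧-zeroʳ; ∨-zeroʳ) renaming (_≟_ to _≟ᵇ_)
open import Data.Fin using (Fin; zero; suc; _<?_) renaming (_≟_ to _≟ᶠ_)
open import Data.Fin.Properties using (any?; all?; <-cmp)
open import Data.Fin.Subset using (_∈_; Nonempty; _∩_; _∪_; ⊥)
open import Data.Fin.Subset.Properties
  using (_∈?_; nonempty?; anySubset?; Empty-unique; ∣⊥∣≡0; ∣p∣≤n)
open import Data.List using (List; []; _∷_; allFin; map; concatMap; tabulate)
open import Data.List.Properties using (map-tabulate)
open import Data.Nat.ListAction using () renaming (sum to sumᴸ)
open import Data.Nat.ListAction.Properties using (sum-++)
open import Data.Nat using (zero; suc; _+_; _<_; z≤n; s≤s; z<s; _≤?_; _∸_; _/_; _%_; NonZero; >-nonZero)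
open import Data.Nat.DivMod using (m≡m%n+[m/n]*n; m%n<n; m/n*n≤m; m*n/n≡m; /-monoˡ-≤)
open import Data.Nat.Properties hiding (_<?_; <-cmp)
open import Data.Nat.Tactic.RingSolver using (solve-∀)
import Data.Integer as ℤ
import Data.Integer.Properties as ℤ
import Data.Rational as ℚ
import Data.Rational.Properties as ℚ
import Data.Rational.Unnormalised as ℚᵘ
import Data.Rational.Unnormalised.Properties as ℚᵘ
open import Data.Product using (_,_; proj₁; proj₂)
open import Data.Sum using (_⊎_; inj₁; inj₂)
import Data.Vec as Vec
open import Data.Vec using (lookup; _[_]≔_)
open import Data.Vec.Properties
  using (lookup-zipWith; lookup∘tabulate; lookup⇒[]=; []=⇒lookup; lookup-replicate)
open import Function using (_∘_; id)
open import Relation.Binary.Definitions using (tri<; tri≈; tri>)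
open import Relation.Binary.PropositionalEquality
  using (refl; cong; cong₂; subst; trans; _≢_) renaming (sym to ≡-sym)
open import Relation.Nullary using (¬_; Dec; yes; no; does; contradiction)
open import Relation.Nullary.Decidable
  using (isYes≗does; _×-dec_; _→-dec_; ¬?; dec-true; dec-false)

open import Algebra.Properties.CommutativeMonoid.Sum +-0-commutativeMonoid
  using (sum-syntax; ∑-distrib-+; ∑-comm; sum-cong-≗; sum-replicate-zero)
  renaming (sum to ∑)
open import Algebra.Properties.Semiring.Sum +-*-semiring using (*-distribˡ-sum)

-- Finite sums and indicator functions.

private
  variable
    n : ℕ

⟦_⟧ : Bool → ℕ
⟦ b ⟧ = if b then 1 else 0

∑-mono-≤ : {f g : Fin n → ℕ} → (∀ i → f i ≤ g i) → ∑ f ≤ ∑ g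
∑-mono-≤ {zero}  f≤g = z≤n
∑-mono-≤ {suc _} f≤g = +-mono-≤ (f≤g zero) (∑-mono-≤ (f≤g ∘ suc))

term≤∑ : (f : Fin n → ℕ) (i : Fin n) → f i ≤ ∑ f
term≤∑ f zero    = m≤m+n _ _
term≤∑ f (suc i) = ≤-trans (term≤∑ (f ∘ suc) i) (m≤n+m _ (f zero))

∑-indicator-≡ : (f : Fin n → ℕ) (i : Fin n) → ∑[ j < n ] (⟦ does (i ≟ᶠ j) ⟧ * f j) ≡ f i
∑-indicator-≡ {suc n} f zero =
  trans (cong₂ _+_ (+-identityʳ (f zero)) (sum-replicate-zero n)) (+-identityʳ _)
∑-indicator-≡ f (suc i) = ∑-indicator-≡ (f ∘ suc) i

sumᴸ-concatMap : {A : Set} (f : A → List ℕ) (xs : List A) →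
  sumᴸ (concatMap f xs) ≡ sumᴸ (map (sumᴸ ∘ f) xs)
sumᴸ-concatMap f []       = refl
sumᴸ-concatMap f (x ∷ xs) =
  trans (sum-++ (f x) (concatMap f xs)) (cong (sumᴸ (f x) +_) (sumᴸ-concatMap f xs))

sumᴸ-tabulate : (f : Fin n → ℕ) → sumᴸ (tabulate f) ≡ ∑ f
sumᴸ-tabulate {zero}  f = refl
sumᴸ-tabulate {suc n} f = cong (f zero +_) (sumᴸ-tabulate (f ∘ suc))

sumᴸ-allFin : (f : Fin n → ℕ) → sumᴸ (map f (allFin n)) ≡ ∑ f
sumᴸ-allFin f = trans (cong sumᴸ (map-tabulate id f)) (sumᴸ-tabulate f)

-- Cardinalities and weights of subsets.

card-∑ : (S : Subset n) → ∣ S ∣ ≡ ∑[ i < n ] ⟦ lookup S i ⟧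
card-∑ Vec.[]            = refl
card-∑ (true  Vec.∷ S) = cong suc (card-∑ S)
card-∑ (false Vec.∷ S) = card-∑ S

-- With `g = deg W`, as defined below, this counts the pairs (v, u) with v in S and u in N[v] ∩ W.
weight : Subset n → (Fin n → ℕ) → ℕ
weight {n} S g = ∑[ v < n ] (⟦ lookup S v ⟧ * g v)

weight-const : (S : Subset n) (c : ℕ) → weight S (λ _ → c) ≡ c * ∣ S ∣
weight-const Vec.[]            c = ≡-sym (*-zeroʳ c)
weight-const (true  Vec.∷ S) c =
  trans (cong₂ _+_ (*-identityˡ c) (weight-const S c)) (≡-sym (*-suc c ∣ S ∣))
weight-const (false Vec.∷ S) c = weight-const S c

weight-mono-≤ : (S : Subset n) {g h : Fin n → ℕ} →
  (∀ v → lookup S v ≡ true → g v ≤ h v) → weight S g ≤ weight S h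
weight-mono-≤ S {g} {h} g≤h = ∑-mono-≤ pointwise
  where
  pointwise : ∀ v → ⟦ lookup S v ⟧ * g v ≤ ⟦ lookup S v ⟧ * h v
  pointwise v with lookup S v in eq
  ... | true  = +-monoˡ-≤ 0 (g≤h v eq)
  ... | false = z≤n

weight-distrib-+ : (S : Subset n) (g h : Fin n → ℕ) →
  weight S (λ v → g v + h v) ≡ weight S g + weight S h
weight-distrib-+ S g h =
  trans (sum-cong-≗ λ v → *-distribˡ-+ ⟦ lookup S v ⟧ (g v) (h v))
        (∑-distrib-+ (λ v → ⟦ lookup S v ⟧ * g v) (λ v → ⟦ lookup S v ⟧ * h v))

-- Extracting light subsets by removing heavy elements.

weight-remove : (S : Subset n) (g : Fin n → ℕ) (x : Fin n) → lookup S x ≡ true →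
  weight S g ≡ g x + weight (S [ x ]≔ false) g
weight-remove (true Vec.∷ S) g zero    refl = cong (_+ weight S (g ∘ suc)) (*-identityˡ (g zero))
weight-remove (b    Vec.∷ S) g (suc x) x∈S  =
  trans (cong (⟦ b ⟧ * g zero +_) (weight-remove S (g ∘ suc) x x∈S))
        (swap (⟦ b ⟧ * g zero) (g (suc x)) _)
  where
  swap : ∀ a b c → a + (b + c) ≡ b + (a + c)
  swap = solve-∀

card-remove : (S : Subset n) (x : Fin n) → lookup S x ≡ true → ∣ S ∣ ≡ suc ∣ S [ x ]≔ false ∣
card-remove S x x∈S =
  trans (≡-sym (*-identityˡ ∣ S ∣))
  (trans (≡-sym (weight-const S 1))
  (trans (weight-remove S (λ _ → 1) x x∈S)
  (cong suc (trans (weight-const (S [ x ]≔ false) 1) (*-identityˡ _)))))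

lookup-remove : (S : Subset n) (x v : Fin n) → lookup (S [ x ]≔ false) v ≡ true → lookup S v ≡ true
lookup-remove (_ Vec.∷ S) zero    (suc v) p = p
lookup-remove (_ Vec.∷ S) (suc x) zero    p = p
lookup-remove (_ Vec.∷ S) (suc x) (suc v) p = lookup-remove S x v p

-- Discarding an element of at least average weight keeps the average below B.
remove-heavy : (g : Fin n → ℕ) (B : ℕ) (S : Subset n) → 0 < ∣ S ∣ → weight S g ≤ B * ∣ S ∣ →
  ∃[ x ] (lookup S x ≡ true × weight (S [ x ]≔ false) g ≤ B * ∣ S [ x ]≔ false ∣)
remove-heavy {n} g B S 0<∣S∣ avg with any? (λ x → (lookup S x ≟ᵇ true) ×-dec (B ≤? g x))
... | yes (x , x∈S , B≤gx) = x , x∈S , +-cancelˡ-≤ B _ _ (begin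
    B + weight S′ g    ≤⟨ +-monoˡ-≤ _ B≤gx ⟩
    g x + weight S′ g  ≡⟨ weight-remove S g x x∈S ⟨
    weight S g         ≤⟨ avg ⟩
    B * ∣ S ∣          ≡⟨ cong (B *_) (card-remove S x x∈S) ⟩
    B * suc ∣ S′ ∣     ≡⟨ *-suc B ∣ S′ ∣ ⟩
    B + B * ∣ S′ ∣     ∎)
  where
  open ≤-Reasoning
  S′ = S [ x ]≔ false
-- When every element of S weighs less than `B`, the bound holds for whatever remains, so any
-- element may go.
... | no light with nonempty? S
...   | yes (x , x∈S) = x , []=⇒lookup x∈S , ≤-trans
        (weight-mono-≤ (S [ x ]≔ false) λ v v∈ →
          <⇒≤ (≰⇒> λ B≤gv → light (v , lookup-remove S x v v∈ , B≤gv)))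
        (≤-reflexive (weight-const (S [ x ]≔ false) B))
...   | no empty = contradiction
        (subst (0 <_) (trans (cong ∣_∣ (Empty-unique empty)) (∣⊥∣≡0 n)) 0<∣S∣) λ ()

-- Induction on the number `k` of elements still to be discarded; each removal keeps the average at
-- most `B`, and the `r` survivors form V.
light-subset : (g : Fin n → ℕ) (B k r : ℕ) (S : Subset n) → ∣ S ∣ ≡ k + r → weight S g ≤ B * ∣ S ∣ →
  ∃[ V ] ((∀ v → lookup V v ≡ true → lookup S v ≡ true) × ∣ V ∣ ≡ r × weight V g ≤ B * r)
light-subset g B zero    r S card avg = S , (λ _ → id) , card , subst (λ t → weight S g ≤ B * t) card avg
light-subset g B (suc k) r S card avg with remove-heavy g B S (subst (0 <_) (≡-sym card) z<s) avg
... | x , x∈S , avg′ with light-subset g B k r (S [ x ]≔ false)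
                            (suc-injective (trans (≡-sym (card-remove S x x∈S)) card)) avg′
...   | V , V⊆ , card-V , light = V , (λ v → lookup-remove S x v ∘ V⊆ v) , card-V , light

∧⁻ : ∀ {b c} → b ∧ c ≡ true → b ≡ true × c ≡ true
∧⁻ {true} {true} refl = refl , refl

-- Symmetric differences and induced edge counts.

card-△ : (I J : Subset n) → ∣ I △ J ∣ + 2 * (∑[ v < n ] ⟦ lookup I v ∧ lookup J v ⟧) ≡ ∣ I ∣ + ∣ J ∣
card-△ Vec.[]            Vec.[]            = refl
card-△ (true  Vec.∷ I) (true  Vec.∷ J) =
  trans (shift ∣ I △ J ∣ _)
  (trans (cong (2 +_) (card-△ I J)) (cong suc (≡-sym (+-suc ∣ I ∣ ∣ J ∣))))
  where
  shift : ∀ x y → x + 2 * (1 + y) ≡ 2 + (x + 2 * y)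
  shift = solve-∀
card-△ (true  Vec.∷ I) (false Vec.∷ J) = cong suc (card-△ I J)
card-△ (false Vec.∷ I) (true  Vec.∷ J) = trans (cong suc (card-△ I J)) (≡-sym (+-suc ∣ I ∣ ∣ J ∣))
card-△ (false Vec.∷ I) (false Vec.∷ J) = card-△ I J

edgesIn-∑ : (G : Graph n) (X : Subset n) →
  edgesIn G X ≡ ∑[ i < n ] ∑[ j < n ] ⟦ does (i <? j) ∧ lookup X i ∧ lookup X j ∧ adj G i j ⟧
edgesIn-∑ {n} G X =
  trans (sumᴸ-concatMap _ (allFin n))
  (trans (sumᴸ-allFin {n} _)
  (sum-cong-≗ λ i → trans (sumᴸ-allFin {n} _)
    (sum-cong-≗ λ j → cong (λ b → ⟦ b ∧ lookup X i ∧ lookup X j ∧ adj G i j ⟧) (isYes≗does (i <? j)))))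

-- Closed neighbourhoods and incidences between independent sets.

module _ (G : Graph n) where

  -- The closed neighbourhood N[v]: containing v itself is what later makes V a subset of N[V].
  nbhd : Fin n → Fin n → Bool
  nbhd v u = does (v ≟ᶠ u) ∨ adj G v u

  deg : Subset n → Fin n → ℕ
  deg W v = ∑[ u < n ] ⟦ nbhd v u ∧ lookup W u ⟧

  nonadjacent : {I : Subset n} → Independent G I → ∀ i j →
    lookup I i ≡ true → lookup I j ≡ true → adj G i j ≡ false
  nonadjacent ind i j i∈ j∈ = ind i j (lookup⇒[]= i _ i∈) (lookup⇒[]= j _ j∈)

  nbhd-≢ : {v u : Fin n} → v ≢ u → nbhd v u ≡ adj G v u
  nbhd-≢ {v} {u} v≢u = cong (_∨ adj G v u) (dec-false (v ≟ᶠ u) v≢u)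

  edge-disjoint : {I : Subset n} → Independent G I → ∀ i j →
    adj G i j ≡ true → lookup I i ∧ lookup I j ≡ false
  edge-disjoint {I} ind i j edge with lookup I i in i∈ | lookup I j in j∈
  ... | false | _     = refl
  ... | true  | false = refl
  ... | true  | true  = contradiction (trans (≡-sym edge) (nonadjacent ind i j i∈ j∈)) λ ()

  weight-deg-∑ : (I J : Subset n) →
    weight I (deg J) ≡ ∑[ v < n ] ∑[ u < n ] ⟦ lookup I v ∧ nbhd v u ∧ lookup J u ⟧
  weight-deg-∑ I J = sum-cong-≗ λ v →
    trans (*-distribˡ-sum ⟦ lookup I v ⟧ (λ u → ⟦ nbhd v u ∧ lookup J u ⟧))
          (sum-cong-≗ λ u → mult (lookup I v) (nbhd v u ∧ lookup J u))
    where
    mult : ∀ b c → ⟦ b ⟧ * ⟦ c ⟧ ≡ ⟦ b ∧ c ⟧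
    mult true  c = +-identityʳ ⟦ c ⟧
    mult false c = refl

  module _ {I J : Subset n} (indI : Independent G I) (indJ : Independent G J) where

    private
      F : Fin n → Fin n → Bool
      F v u = lookup I v ∧ nbhd v u ∧ lookup J u

      -- `edgesIn` counts only pairs with `v <? u`. `L` keeps the incidences already in that order,
      -- `U` stores the reversed ones transposed into it, and `D` isolates the diagonal in a form
      -- that `∑-indicator-≡` collapses.
      L U D : Fin n → Fin n → ℕ
      L v u = ⟦ does (v <? u) ∧ F v u ⟧
      U v u = ⟦ does (v <? u) ∧ F u v ⟧
      D v u = ⟦ does (v ≟ᶠ u) ⟧ * ⟦ lookup I u ∧ lookup J u ⟧

      diagonal : ∀ v → ⟦ F v v ⟧ ≤ D v v
      diagonal v rewrite dec-true (v ≟ᶠ v) refl = ≤-reflexive (≡-sym (+-identityʳ _))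

      split : ∀ v u → ⟦ F v u ⟧ ≤ (L v u + U u v) + D v u
      split v u with <-cmp v u
      ... | tri< v<u _ _ rewrite dec-true (v <? u) v<u = ≤-trans (m≤m+n _ _) (m≤m+n _ _)
      ... | tri> _ _ u<v rewrite dec-true (u <? v) u<v = ≤-trans (m≤n+m _ (L v u)) (m≤m+n _ _)
      ... | tri≈ _ refl _ = ≤-trans (diagonal v) (m≤n+m (D v v) (L v v + U v v))

      -- The arguments are the memberships of the ends of an edge vu in I and J. Independence allows
      -- each set at most one end, so an edge from I to J runs between I minus J and J minus I: both
      -- ends lie in the symmetric difference, and only one of the two orientations occurs.
      edge-bound : ∀ iv iu jv ju → iv ∧ iu ≡ false → jv ∧ ju ≡ false →
        ⟦ iv ∧ ju ⟧ + ⟦ iu ∧ jv ⟧ ≤ ⟦ (iv xor jv) ∧ (iu xor ju) ∧ true ⟧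
      edge-bound true  true  _     _     () _
      edge-bound _     _     true  true  _ ()
      edge-bound true  false true  false _ _ = z≤n
      edge-bound true  false false true  _ _ = s≤s z≤n
      edge-bound true  false false false _ _ = z≤n
      edge-bound false true  true  false _ _ = s≤s z≤n
      edge-bound false true  false true  _ _ = z≤n
      edge-bound false true  false false _ _ = z≤n
      edge-bound false false _     _     _ _ = z≤n

      off-diagonal : ∀ v u → L v u + U v u ≤
        ⟦ does (v <? u) ∧ lookup (I △ J) v ∧ lookup (I △ J) u ∧ adj G v u ⟧
      off-diagonal v u with v <? u
      ... | no v≮u rewrite dec-false (v <? u) v≮u = z≤n
      ... | yes v<u
        rewrite dec-true (v <? u) v<u
              | nbhd-≢ {v} {u} (λ { refl → <-irrefl refl v<u })
              | nbhd-≢ {u} {v} (λ { refl → <-irrefl refl v<u })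
              | sym G u v
              | lookup-zipWith _xor_ v I J | lookup-zipWith _xor_ u I J
        with adj G v u in edge
      ...   | true  = edge-bound (lookup I v) (lookup I u) (lookup J v) (lookup J u)
                        (edge-disjoint indI v u edge) (edge-disjoint indJ v u edge)
      -- Distinct nonadjacent vertices contribute nothing; the case split only lets the conjunctions
      -- compute.
      ...   | false with lookup I v | lookup I u
      ...     | true  | true  = z≤n
      ...     | true  | false = z≤n
      ...     | false | true  = z≤n
      ...     | false | false = z≤n

    -- A vertex u of N[v] ∩ J with v in I is either v itself, hence a common vertex, or the other
    -- end of an edge of G[I △ J], and each such edge arises at most once.
    weight-deg≤edgesIn : weight I (deg J) ≤ edgesIn G (I △ J) + ∑[ v < n ] ⟦ lookup I v ∧ lookup J v ⟧
    weight-deg≤edgesIn = begin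
      weight I (deg J)
        ≡⟨ weight-deg-∑ I J ⟩
      (∑[ v < n ] ∑[ u < n ] ⟦ F v u ⟧)
        ≤⟨ (∑-mono-≤ λ v → ∑-mono-≤ (split v)) ⟩
      (∑[ v < n ] ∑[ u < n ] ((L v u + U u v) + D v u))
        ≡⟨ (sum-cong-≗ λ v → ∑-distrib-+ (λ u → L v u + U u v) (D v)) ⟩
      (∑[ v < n ] ((∑[ u < n ] (L v u + U u v)) + ∑ (D v)))
        ≡⟨ ∑-distrib-+ {n} _ _ ⟩
      (∑[ v < n ] ∑[ u < n ] (L v u + U u v)) + (∑[ v < n ] ∑ (D v))
        ≡⟨ cong₂ _+_ symmetrize (sum-cong-≗ (∑-indicator-≡ (λ u → ⟦ lookup I u ∧ lookup J u ⟧))) ⟩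
      (∑[ v < n ] ∑[ u < n ] (L v u + U v u)) + (∑[ v < n ] ⟦ lookup I v ∧ lookup J v ⟧)
        ≤⟨ +-monoˡ-≤ _ (∑-mono-≤ λ v → ∑-mono-≤ (off-diagonal v)) ⟩
      (∑[ v < n ] ∑[ u < n ] ⟦ does (v <? u) ∧ lookup (I △ J) v ∧ lookup (I △ J) u ∧ adj G v u ⟧)
        + (∑[ v < n ] ⟦ lookup I v ∧ lookup J v ⟧)
        ≡⟨ cong (_+ _) (edgesIn-∑ G (I △ J)) ⟨
      edgesIn G (I △ J) + (∑[ v < n ] ⟦ lookup I v ∧ lookup J v ⟧) ∎
      where
      open ≤-Reasoning
      ∑∑-distrib-+ : (f g : Fin n → Fin n → ℕ) → ∑[ v < n ] ∑[ u < n ] (f v u + g v u)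
        ≡ (∑[ v < n ] ∑ (f v)) + (∑[ v < n ] ∑ (g v))
      ∑∑-distrib-+ f g = trans (sum-cong-≗ λ v → ∑-distrib-+ (f v) (g v)) (∑-distrib-+ {n} _ _)
      symmetrize : ∑[ v < n ] ∑[ u < n ] (L v u + U u v) ≡ ∑[ v < n ] ∑[ u < n ] (L v u + U v u)
      symmetrize = trans (∑∑-distrib-+ L (λ v u → U u v))
        (trans (cong ((∑[ v < n ] ∑ (L v)) +_) (∑-comm (λ v u → U u v)))
        (≡-sym (∑∑-distrib-+ L U)))

  deg-∪ : (W J : Subset n) (v : Fin n) → deg (W ∪ J) v ≤ deg W v + deg J v
  deg-∪ W J v = ≤-trans (∑-mono-≤ pointwise) (≤-reflexive
    (∑-distrib-+ (λ u → ⟦ nbhd v u ∧ lookup W u ⟧) (λ u → ⟦ nbhd v u ∧ lookup J u ⟧)))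
    where
    union-bound : ∀ b w j → ⟦ b ∧ (w ∨ j) ⟧ ≤ ⟦ b ∧ w ⟧ + ⟦ b ∧ j ⟧
    union-bound false _     _ = z≤n
    union-bound true  true  _ = s≤s z≤n
    union-bound true  false _ = ≤-refl
    pointwise : ∀ u → ⟦ nbhd v u ∧ lookup (W ∪ J) u ⟧ ≤ ⟦ nbhd v u ∧ lookup W u ⟧ + ⟦ nbhd v u ∧ lookup J u ⟧
    pointwise u rewrite lookup-zipWith _∨_ u W J = union-bound (nbhd v u) (lookup W u) (lookup J u)

  weight-deg-⊥ : (S : Subset n) → weight S (deg ⊥) ≡ 0
  weight-deg-⊥ S = trans (sum-cong-≗ λ v → trans (cong (⟦ lookup S v ⟧ *_) (deg-⊥ v)) (*-zeroʳ ⟦ lookup S v ⟧))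
                         (sum-replicate-zero n)
    where
    outside-⊥ : ∀ v u → ⟦ nbhd v u ∧ lookup ⊥ u ⟧ ≡ 0
    outside-⊥ v u rewrite lookup-replicate u false = cong ⟦_⟧ (∧-zeroʳ (nbhd v u))
    deg-⊥ : ∀ v → deg ⊥ v ≡ 0
    deg-⊥ v = trans (sum-cong-≗ (outside-⊥ v)) (sum-replicate-zero n)

  -- Hitting sets, barriers and the exchange argument.

  independent? : (S : Subset n) → Dec (Independent G S)
  independent? S = all? λ i → all? λ j → (i ∈? S) →-dec ((j ∈? S) →-dec (adj G i j ≟ᵇ false))

  -- An independent set at least as large as `I₀` is maximum, so a finite search testing
  -- independence and size suffices to find a missed set.
  hits-or-escapes : {I₀ : Subset n} → MaxIndependent G I₀ → (T : Subset n) →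
    HittingSet G T ⊎ (∃[ I ] (MaxIndependent G I × ¬ Nonempty (T ∩ I)))
  hits-or-escapes {I₀} (ind₀ , max₀) T
    with anySubset? (λ I → independent? I ×-dec ((∣ I₀ ∣ ≤? ∣ I ∣) ×-dec ¬? (nonempty? (T ∩ I))))
  ... | yes (I , indI , large , esc) = inj₂ (I , (indI , λ S indS → ≤-trans (max₀ S indS) large) , esc)
  ... | no all-hit = inj₁ hits
    where
    hits : HittingSet G T
    hits I (indI , maxI) with nonempty? (T ∩ I)
    ... | yes meets = meets
    ... | no  esc   = contradiction (I , indI , maxI I₀ ind₀ , esc) all-hit

  dominated? : (V : Subset n) (u : Fin n) → Dec (∃[ v ] (lookup V v ∧ nbhd v u ≡ true))
  dominated? V u = any? λ v → (lookup V v ∧ nbhd v u) ≟ᵇ true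

  dominated : Subset n → Fin n → Bool
  dominated V u = does (dominated? V u)

  -- N[V] ∩ W, the candidate hitting set.
  barrier : Subset n → Subset n → Subset n
  barrier V W = Vec.tabulate λ u → dominated V u ∧ lookup W u

  -- Double counting: every vertex of the barrier is dominated by at least one v in V, while the
  -- weight counts all dominating v.
  card-barrier : (V W : Subset n) → ∣ barrier V W ∣ ≤ weight V (deg W)
  card-barrier V W = begin
    ∣ barrier V W ∣
      ≡⟨ card-∑ (barrier V W) ⟩
    (∑[ u < n ] ⟦ lookup (barrier V W) u ⟧)
      ≤⟨ ∑-mono-≤ pointwise ⟩
    (∑[ u < n ] ∑[ v < n ] ⟦ lookup V v ∧ nbhd v u ∧ lookup W u ⟧)
      ≡⟨ ∑-comm (λ u v → ⟦ lookup V v ∧ nbhd v u ∧ lookup W u ⟧) ⟩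
    (∑[ v < n ] ∑[ u < n ] ⟦ lookup V v ∧ nbhd v u ∧ lookup W u ⟧)
      ≡⟨ weight-deg-∑ V W ⟨
    weight V (deg W) ∎
    where
    open ≤-Reasoning
    pointwise : ∀ u → ⟦ lookup (barrier V W) u ⟧ ≤ ∑[ v < n ] ⟦ lookup V v ∧ nbhd v u ∧ lookup W u ⟧
    pointwise u rewrite lookup∘tabulate (λ u → dominated V u ∧ lookup W u) u
      with dominated? V u
    ... | no  _         = z≤n
    ... | yes (v , dom) = ≤-trans
      (≤-reflexive (cong ⟦_⟧ (trans (cong (_∧ lookup W u) (≡-sym dom))
        (∧-assoc (lookup V v) (nbhd v u) (lookup W u)))))
      (term≤∑ (λ v → ⟦ lookup V v ∧ nbhd v u ∧ lookup W u ⟧) v)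

  V-dominated : (V : Subset n) {u : Fin n} → lookup V u ≡ true → dominated V u ≡ true
  V-dominated V {u} u∈V = dec-true (dominated? V u)
    (u , cong₂ _∧_ u∈V (cong (_∨ adj G u u) (dec-true (u ≟ᶠ u) refl)))

  adj-dominated : (V : Subset n) {v u : Fin n} → lookup V v ≡ true → adj G v u ≡ true → dominated V u ≡ true
  adj-dominated V {v} {u} v∈V edge = dec-true (dominated? V u)
    (v , cong₂ _∧_ v∈V (trans (cong (does (v ≟ᶠ u) ∨_) edge) (∨-zeroʳ _)))

  -- Exchanging I ∩ N[V] for V keeps I independent, so maximality forces |I ∩ N[V]| ≥ |V|;
  -- as I avoids the barrier N[V] ∩ W, all of I ∩ N[V] is new to W.
  escape-gain : {V W I : Subset n} → Independent G V → MaxIndependent G I →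
    ¬ Nonempty (barrier V W ∩ I) → ∣ V ∣ + ∣ W ∣ ≤ ∣ W ∪ I ∣
  escape-gain {V} {W} {I} indV (indI , maxI) esc = +-cancelʳ-≤ ∣ I ∣ _ _ (begin
    ∣ V ∣ + ∣ W ∣ + ∣ I ∣
      ≡⟨ cong₂ _+_ (cong₂ _+_ (card-∑ V) (card-∑ W)) (card-∑ I) ⟩
    ∑ (χ V) + ∑ (χ W) + ∑ (χ I)
      ≡⟨ cong (_+ ∑ (χ I)) (∑-distrib-+ (χ V) (χ W)) ⟨
    (∑[ u < n ] (χ V u + χ W u)) + ∑ (χ I)
      ≡⟨ ∑-distrib-+ (λ u → χ V u + χ W u) (χ I) ⟨
    (∑[ u < n ] (χ V u + χ W u + χ I u))
      ≤⟨ ∑-mono-≤ pointwise ⟩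
    (∑[ u < n ] (χ (W ∪ I) u + χ Y u))
      ≡⟨ ∑-distrib-+ (χ (W ∪ I)) (χ Y) ⟩
    ∑ (χ (W ∪ I)) + ∑ (χ Y)
      ≡⟨ cong₂ _+_ (card-∑ (W ∪ I)) (card-∑ Y) ⟨
    ∣ W ∪ I ∣ + ∣ Y ∣
      ≤⟨ +-monoʳ-≤ ∣ W ∪ I ∣ (maxI Y indY) ⟩
    ∣ W ∪ I ∣ + ∣ I ∣ ∎)
    where
    open ≤-Reasoning
    χ : Subset n → Fin n → ℕ
    χ S u = ⟦ lookup S u ⟧
    inY : Fin n → Bool
    inY u = lookup V u ∨ (lookup I u ∧ not (dominated V u))
    Y : Subset n
    Y = Vec.tabulate inY

    cases : ∀ b i d → b ∨ (i ∧ not d) ≡ true → b ≡ true ⊎ (i ≡ true × d ≡ false)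
    cases true  _    _     _    = inj₁ refl
    cases false true false refl = inj₂ (refl , refl)

    nonadjacent-across : ∀ {i j} → lookup V i ≡ true → dominated V j ≡ false → adj G i j ≡ false
    nonadjacent-across {i} {j} i∈V j∉N with adj G i j in edge
    ... | false = refl
    ... | true  = contradiction (trans (≡-sym (adj-dominated V i∈V edge)) j∉N) λ ()

    Y-cases : ∀ {i} → i ∈ Y → lookup V i ≡ true ⊎ (lookup I i ≡ true × dominated V i ≡ false)
    Y-cases {i} i∈Y = cases _ _ _ (trans (≡-sym (lookup∘tabulate inY i)) ([]=⇒lookup i∈Y))

    indY : Independent G Y
    indY i j i∈Y j∈Y with Y-cases i∈Y | Y-cases j∈Y
    ... | inj₁ i∈V         | inj₁ j∈V         = nonadjacent indV i j i∈V j∈V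
    ... | inj₁ i∈V         | inj₂ (_   , j∉N) = nonadjacent-across i∈V j∉N
    ... | inj₂ (_   , i∉N) | inj₁ j∈V         = trans (sym G i j) (nonadjacent-across j∈V i∉N)
    ... | inj₂ (i∈I , _)   | inj₂ (j∈I , _)   = nonadjacent indI i j i∈I j∈I

    -- The arguments are the memberships of one vertex in V, W, I and N[V]; the hypotheses say that
    -- V lies in N[V] and that I avoids the barrier. A vertex of W ∩ I, counted once in W ∪ I, is
    -- then outside N[V] and is counted again in Y. Summing over vertices avoids any subtraction of
    -- cardinalities.
    exchange : ∀ v w i d → (v ≡ true → d ≡ true) → ¬ ((d ∧ w) ∧ i ≡ true) →
      ⟦ v ⟧ + ⟦ w ⟧ + ⟦ i ⟧ ≤ ⟦ w ∨ i ⟧ + ⟦ v ∨ (i ∧ not d) ⟧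
    exchange true  _     _     false v⇒d _   = contradiction (v⇒d refl) λ ()
    exchange _     true  true  true  _   esc = contradiction refl esc
    exchange true  true  false true  _   _   = ≤-refl
    exchange true  false true  true  _   _   = ≤-refl
    exchange true  false false true  _   _   = ≤-refl
    exchange false true  true  false _   _   = ≤-refl
    exchange false true  false _     _   _   = s≤s z≤n
    exchange false false true  _     _   _   = s≤s z≤n
    exchange false false false _     _   _   = z≤n

    pointwise : ∀ u → χ V u + χ W u + χ I u ≤ χ (W ∪ I) u + χ Y u
    pointwise u rewrite lookup-zipWith _∨_ u W I | lookup∘tabulate inY u =
      exchange (lookup V u) (lookup W u) (lookup I u) (dominated V u) (V-dominated V) λ hit →
        esc (u , lookup⇒[]= u _ (trans (lookup-zipWith _∧_ u (barrier V W) I)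
          (trans (cong (_∧ lookup I u) (lookup∘tabulate _ u)) hit)))

  -- Growing a union of maximum independent sets.

  SmallHitting : ℕ → Set
  SmallHitting D = ∃[ T ] (HittingSet G T × ∣ T ∣ ≤ D)

  module _ {I₀ : Subset n} (max₀ : MaxIndependent G I₀) {s : ℕ} (1≤s : 1 ≤ s)
    (sparse : (I₁ I₂ : Subset n) → MaxIndependent G I₁ → MaxIndependent G I₂ →
      edgesIn G (I₁ △ I₂) ≤ s * ∣ I₁ △ I₂ ∣) where

    -- On average over v in `I₀`, N[v] meets J in at most 2s vertices, whatever maximum independent
    -- set J is.
    weight-deg-maximum : {J : Subset n} → MaxIndependent G J → weight I₀ (deg J) ≤ 2 * s * ∣ I₀ ∣
    weight-deg-maximum {J} maxJ@(indJ , _) = begin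
      weight I₀ (deg J)                  ≤⟨ weight-deg≤edgesIn (proj₁ max₀) indJ ⟩
      edgesIn G (I₀ △ J) + c             ≤⟨ +-mono-≤ (sparse I₀ J max₀ maxJ) c≤s*2c ⟩
      s * ∣ I₀ △ J ∣ + s * (2 * c)       ≡⟨ *-distribˡ-+ s ∣ I₀ △ J ∣ (2 * c) ⟨
      s * (∣ I₀ △ J ∣ + 2 * c)           ≡⟨ cong (s *_) (card-△ I₀ J) ⟩
      s * (∣ I₀ ∣ + ∣ J ∣)               ≤⟨ *-monoʳ-≤ s (+-monoʳ-≤ ∣ I₀ ∣ (proj₂ max₀ J indJ)) ⟩
      s * (∣ I₀ ∣ + ∣ I₀ ∣)              ≡⟨ double s ∣ I₀ ∣ ⟩
      2 * s * ∣ I₀ ∣                     ∎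
      where
      open ≤-Reasoning
      c = ∑[ v < n ] ⟦ lookup I₀ v ∧ lookup J v ⟧
      double : ∀ s a → s * (a + a) ≡ 2 * s * a
      double = solve-∀
      -- `1 ≤ s` lets the common vertices be charged as `s * (2 * c)`, the term that `card-△` needs
      -- to turn the symmetric difference into |I₀| + |J|.
      c≤s*2c : c ≤ s * (2 * c)
      c≤s*2c = ≤-trans (m≤m+n c (c + 0))
        (≤-trans (≤-reflexive (≡-sym (*-identityˡ _))) (*-monoˡ-≤ (2 * c) 1≤s))

    -- W stands for a union of j maximum independent sets; only their total weight matters.
    Reached : ℕ → ℕ → Set
    Reached j w = ∃[ W ] (w ≤ ∣ W ∣ × weight I₀ (deg W) ≤ 2 * s * j * ∣ I₀ ∣)

    -- The empty union already meets the bound for j = 1; starting there rather than at 0 aligns the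
    -- count with the first dyadic block, at 2^0.
    start : Reached 1 0
    start = ⊥ , z≤n , subst (_≤ 2 * s * 1 * ∣ I₀ ∣) (≡-sym (weight-deg-⊥ I₀)) z≤n

    -- The barrier of `r` light vertices of `I₀` has at most 2sjr elements. If it misses some I,
    -- adding I to W gains at least `r` vertices and raises the average bound by 2s.
    grow : ∀ {D} j w r → r ≤ ∣ I₀ ∣ → 2 * s * j * r ≤ D → Reached j w →
      SmallHitting D ⊎ Reached (suc j) (w + r)
    grow j w r r≤a budget (W , w≤W , avg)
      with light-subset (deg W) (2 * s * j) (∣ I₀ ∣ ∸ r) r I₀ (≡-sym (m∸n+n≡m r≤a)) avg
    ... | V , V⊆I₀ , card-V , light with hits-or-escapes max₀ (barrier V W)
    ...   | inj₁ hits = inj₁ (barrier V W , hits , ≤-trans (card-barrier V W) (≤-trans light budget))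
    ...   | inj₂ (I , maxI , esc) = inj₂ (W ∪ I , gain , avg′)
      where
      open ≤-Reasoning
      indV : Independent G V
      indV i j i∈ j∈ = nonadjacent (proj₁ max₀) i j (V⊆I₀ i ([]=⇒lookup i∈)) (V⊆I₀ j ([]=⇒lookup j∈))
      gain : w + r ≤ ∣ W ∪ I ∣
      gain = begin
        w + r          ≤⟨ +-monoˡ-≤ r w≤W ⟩
        ∣ W ∣ + r      ≡⟨ cong (∣ W ∣ +_) card-V ⟨
        ∣ W ∣ + ∣ V ∣  ≡⟨ +-comm ∣ W ∣ ∣ V ∣ ⟩
        ∣ V ∣ + ∣ W ∣  ≤⟨ escape-gain {W = W} indV maxI esc ⟩
        ∣ W ∪ I ∣      ∎
      expand : ∀ s j a → 2 * s * j * a + 2 * s * a ≡ 2 * s * suc j * a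
      expand = solve-∀
      avg′ : weight I₀ (deg (W ∪ I)) ≤ 2 * s * suc j * ∣ I₀ ∣
      avg′ = begin
        weight I₀ (deg (W ∪ I))                   ≤⟨ weight-mono-≤ I₀ (λ v _ → deg-∪ W I v) ⟩
        weight I₀ (λ v → deg W v + deg I v)       ≡⟨ weight-distrib-+ I₀ (deg W) (deg I) ⟩
        weight I₀ (deg W) + weight I₀ (deg I)     ≤⟨ +-mono-≤ avg (weight-deg-maximum maxI) ⟩
        2 * s * j * ∣ I₀ ∣ + 2 * s * ∣ I₀ ∣       ≡⟨ expand s j ∣ I₀ ∣ ⟩
        2 * s * suc j * ∣ I₀ ∣                    ∎

    -- With `r` fixed, a budget that suffices at index `M` suffices at every earlier step.
    grow-block : ∀ {D} M r → r ≤ ∣ I₀ ∣ → 2 * s * M * r ≤ D →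
      ∀ k j w → k + j ≤ M → Reached j w → SmallHitting D ⊎ Reached (k + j) (w + k * r)
    grow-block M r r≤a budget zero    j w _     st = inj₂ (subst (Reached j) (≡-sym (+-identityʳ w)) st)
    grow-block M r r≤a budget (suc k) j w k+j<M st
      with grow-block M r r≤a budget k j w (<⇒≤ k+j<M) st
    ... | inj₁ hit = inj₁ hit
    ... | inj₂ st′
      with grow (k + j) (w + k * r) r r≤a
             (≤-trans (*-monoˡ-≤ r (*-monoʳ-≤ (2 * s) (<⇒≤ k+j<M))) budget) st′
    ...   | inj₁ hit = inj₁ hit
    ...   | inj₂ st″ = inj₂ (subst (Reached (suc k + j)) (shuffle w k r) st″)
      where
      shuffle : ∀ w k r → w + k * r + r ≡ w + suc k * r
      shuffle = solve-∀

    -- The block of steps 2^i ≤ j < 2^(i+1) uses r = ⌊5n / (4 L 2^i)⌋; rounding r down costs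
    -- the term 2^i in the accumulated bound.
    grow-dyadic : ∀ L q → .{{_ : NonZero L}} → 5 * q ≤ 4 * L → n ≤ q * ∣ I₀ ∣ →
      let D = 5 * s * n / L in
      ∀ i → SmallHitting D ⊎ ∃[ w ] (Reached (2 ^ i) w × 5 * n * i ≤ 4 * L * (w + 2 ^ i))
    grow-dyadic L q 5q≤4L n≤qa zero = inj₂ (0 , start , subst (_≤ 4 * L * 1) (≡-sym (*-zeroʳ (5 * n))) z≤n)
    grow-dyadic L q 5q≤4L n≤qa (suc i) with grow-dyadic L q 5q≤4L n≤qa i
    ... | inj₁ hit = inj₁ hit
    ... | inj₂ (w , st , bound) = result
      where
      open ≤-Reasoning
      p = 2 ^ i
      instance
        p≢0 : NonZero p
        p≢0 = m^n≢0 2 i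
        4L≢0 : NonZero (4 * L)
        4L≢0 = m*n≢0 4 L
        4Lp≢0 : NonZero (4 * L * p)
        4Lp≢0 = m*n≢0 (4 * L) p
      r = 5 * n / (4 * L * p)

      r-upper : r * (4 * L * p) ≤ 5 * n
      r-upper = m/n*n≤m (5 * n) (4 * L * p)

      r-lower : 5 * n ≤ suc r * (4 * L * p)
      r-lower = begin
        5 * n                                        ≡⟨ m≡m%n+[m/n]*n (5 * n) (4 * L * p) ⟩
        5 * n % (4 * L * p) + r * (4 * L * p)        ≤⟨ +-monoˡ-≤ _ (<⇒≤ (m%n<n (5 * n) (4 * L * p))) ⟩
        suc r * (4 * L * p)                          ∎

      -- The density of `I₀` enters here: `r` is at most 5n / 4L, and `q` bounds n / |I₀|.
      r≤a : r ≤ ∣ I₀ ∣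
      r≤a = *-cancelʳ-≤ r ∣ I₀ ∣ (4 * L) (begin
        r * (4 * L)           ≤⟨ *-monoʳ-≤ r (m≤m*n (4 * L) p) ⟩
        r * (4 * L * p)       ≤⟨ r-upper ⟩
        5 * n                 ≤⟨ *-monoʳ-≤ 5 n≤qa ⟩
        5 * (q * ∣ I₀ ∣)      ≡⟨ *-assoc 5 q ∣ I₀ ∣ ⟨
        5 * q * ∣ I₀ ∣        ≤⟨ *-monoˡ-≤ ∣ I₀ ∣ 5q≤4L ⟩
        4 * L * ∣ I₀ ∣        ≡⟨ *-comm (4 * L) ∣ I₀ ∣ ⟩
        ∣ I₀ ∣ * (4 * L)      ∎)

      regroup : ∀ s p r L → 2 * s * (2 * p) * r * L ≡ s * (r * (4 * L * p))
      regroup = solve-∀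

      reorder : ∀ s n → s * (5 * n) ≡ 5 * s * n
      reorder = solve-∀

      -- Indices in the block stay below 2p, and 2s · 2p · r · L = s · 4Lpr is at most 5sn.
      budget : 2 * s * (2 * p) * r ≤ 5 * s * n / L
      budget = begin
        2 * s * (2 * p) * r              ≡⟨ m*n/n≡m (2 * s * (2 * p) * r) L ⟨
        2 * s * (2 * p) * r * L / L      ≡⟨ cong (_/ L) (regroup s p r L) ⟩
        s * (r * (4 * L * p)) / L        ≤⟨ /-monoˡ-≤ L (*-monoʳ-≤ s r-upper) ⟩
        s * (5 * n) / L                  ≡⟨ cong (_/ L) (reorder s n) ⟩
        5 * s * n / L                    ∎

      accumulate : ∀ L w p r → 4 * L * (w + p) + suc r * (4 * L * p) ≡ 4 * L * (w + p * r + 2 * p)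
      accumulate = solve-∀

      p+p≡2p : p + p ≡ 2 * p
      p+p≡2p = cong (p +_) (≡-sym (+-identityʳ p))

      result : SmallHitting (5 * s * n / L) ⊎
        ∃[ w ] (Reached (2 ^ suc i) w × 5 * n * suc i ≤ 4 * L * (w + 2 ^ suc i))
      result with grow-block (2 * p) r r≤a budget p p w (≤-reflexive p+p≡2p) st
      ... | inj₁ hit = inj₁ hit
      ... | inj₂ st′ = inj₂ (w + p * r , subst (λ k → Reached k (w + p * r)) p+p≡2p st′ , (begin
        5 * n * suc i                              ≡⟨ *-suc (5 * n) i ⟩
        5 * n + 5 * n * i                          ≡⟨ +-comm (5 * n) (5 * n * i) ⟩
        5 * n * i + 5 * n                          ≤⟨ +-mono-≤ bound r-lower ⟩
        4 * L * (w + p) + suc r * (4 * L * p)      ≡⟨ accumulate L w p r ⟩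
        4 * L * (w + p * r + 2 * p)                ∎))

-- Logarithms, density and the choice of parameters.

⌊log₂⌋-exists : ∀ n → 1 ≤ n → ∃[ l ] (2 ^ l ≤ n × n < 2 ^ suc l)
⌊log₂⌋-exists (suc zero)    _ = 0 , ≤-refl , ≤-refl
⌊log₂⌋-exists (suc (suc n)) _ with ⌊log₂⌋-exists (suc n) (s≤s z≤n)
... | l , lo , hi with 2 ^ suc l ≤? suc (suc n)
...   | yes big = suc l , big , ≤-<-trans hi (^-monoʳ-< 2 (s≤s (s≤s z≤n)) (n<1+n (suc l)))
...   | no  ¬big = l , m≤n⇒m≤1+n lo , ≰⇒> ¬big

-- A positive rational has numerator at least 1, so clearing the denominator in a = cn gives a
-- linear lower bound on a.
denominator-bound : (c : ℚ) → Positive c → ∀ a n → ℕtoℚ a ≡ c *ℚ ℕtoℚ n → n ≤ ℚ.↧ₙ c * a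
denominator-bound c@(ℚ.mkℚ (ℤ.+ suc p) d _) _ a n eq = begin
  n                      ≤⟨ m≤m+n n (p * n) ⟩
  suc p * n              ≡⟨ *-identityʳ (suc p * n) ⟨
  suc p * n * 1          ≡⟨ cross (ℚᵘ.drop-*≡* fractions) ⟨
  a * (suc d * 1)        ≡⟨ cong (a *_) (*-identityʳ (suc d)) ⟩
  a * suc d              ≡⟨ *-comm a (suc d) ⟩
  suc d * a              ∎
  where
  open ≤-Reasoning
  fractions : ℚᵘ.mkℚᵘ (ℤ.+ a) 0 ℚᵘ.≃ ℚᵘ.mkℚᵘ (ℤ.+ suc p) d ℚᵘ.* ℚᵘ.mkℚᵘ (ℤ.+ n) 0
  -- `ℕtoℚ` normalises its fraction, so the equation is moved to unnormalised rationals, where it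
  -- cross-multiplies.
  fractions =
    ℚᵘ.≃-trans (ℚᵘ.≃-sym (ℚ.toℚᵘ-fromℚᵘ (ℚᵘ.mkℚᵘ (ℤ.+ a) 0)))
    (ℚᵘ.≃-trans (ℚ.toℚᵘ-cong eq)
    (ℚᵘ.≃-trans (ℚ.toℚᵘ-homo-* c (ℕtoℚ n))
    (ℚᵘ.*-congˡ {ℚ.toℚᵘ c} (ℚ.toℚᵘ-fromℚᵘ (ℚᵘ.mkℚᵘ (ℤ.+ n) 0)))))
  cross : ℤ.+ a ℤ.* ℤ.+ (suc d * 1) ≡ (ℤ.+ suc p ℤ.* ℤ.+ n) ℤ.* ℤ.+ 1 → a * (suc d * 1) ≡ suc p * n * 1
  cross e = ℤ.+-injective (trans (ℤ.pos-* a (suc d * 1)) (trans e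
    (trans (cong (ℤ._* ℤ.+ 1) (≡-sym (ℤ.pos-* (suc p) n))) (≡-sym (ℤ.pos-* (suc p * n) 1)))))

-- Doubling the bound and inserting `w ≤ n` and `8 * p ≤ n` leaves 10m ≤ 9(4 + m), that is m ≤ 36.
-- The surplus of 5 over 4 pays for the rounding term `p`.
growth-exceeds-n : ∀ n m p w → .{{_ : NonZero n}} → 8 * p ≤ n → w ≤ n → 37 ≤ m →
  ¬ (5 * n * m ≤ 4 * (4 + m) * (w + p))
growth-exceeds-n n m p w 8p≤n w≤n 37≤m bound = <⇒≱ 37≤m m≤36
  where
  open ≤-Reasoning
  left : ∀ m n → 10 * m * n ≡ 2 * (5 * n * m)
  left = solve-∀
  distribute : ∀ m w p → 2 * (4 * (4 + m) * (w + p)) ≡ 8 * (4 + m) * w + (4 + m) * (8 * p)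
  distribute = solve-∀
  collect : ∀ m n → 8 * (4 + m) * n + (4 + m) * n ≡ (36 + 9 * m) * n
  collect = solve-∀
  peel : ∀ m → 10 * m ≡ m + 9 * m
  peel = solve-∀
  10m≤36+9m : 10 * m ≤ 36 + 9 * m
  10m≤36+9m = *-cancelʳ-≤ (10 * m) (36 + 9 * m) n (begin
    10 * m * n                           ≡⟨ left m n ⟩
    2 * (5 * n * m)                      ≤⟨ *-monoʳ-≤ 2 bound ⟩
    2 * (4 * (4 + m) * (w + p))          ≡⟨ distribute m w p ⟩
    8 * (4 + m) * w + (4 + m) * (8 * p)  ≤⟨ +-mono-≤ (*-monoʳ-≤ (8 * (4 + m)) w≤n) (*-monoʳ-≤ (4 + m) 8p≤n) ⟩
    8 * (4 + m) * n + (4 + m) * n        ≡⟨ collect m n ⟩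
    (36 + 9 * m) * n                     ∎)
  m≤36 : m ≤ 36
  m≤36 = +-cancelʳ-≤ (9 * m) m 36 (subst (_≤ 36 + 9 * m) (peel m) 10m≤36+9m)

-- The conclusion is |T| log n ≤ 5sn with the logarithm exponentiated away.
theorem3p1 : (c : ℚ) → Positive c → (s : ℕ) → 1 ≤ s →
    ∃[ N ] ((n : ℕ) → N ≤ n → (G : Graph n) →
    (∃[ a ] (IndependenceNumber G a × ℕtoℚ a ≡ c *ℚ ℕtoℚ n)) →
    ((I₁ I₂ : Subset n) → MaxIndependent G I₁ → MaxIndependent G I₂ →
    edgesIn G (I₁ △ I₂) ≤ s * ∣ I₁ △ I₂ ∣) →
    Σ (Subset n) (λ T → HittingSet G T × n ^ ∣ T ∣ ≤ 2 ^ (5 * s * n)))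
-- This threshold forces m ≥ 2q + 37 below: 2q makes `r` at most |I₀|, and 37 makes the growth
-- contradictory.
theorem3p1 c c>0 s 1≤s = 2 ^ (2 * q + 40) , main
  where
  q = ℚ.↧ₙ c
  main : (n : ℕ) → 2 ^ (2 * q + 40) ≤ n → (G : Graph n) →
    (∃[ a ] (IndependenceNumber G a × ℕtoℚ a ≡ c *ℚ ℕtoℚ n)) →
    ((I₁ I₂ : Subset n) → MaxIndependent G I₁ → MaxIndependent G I₂ →
    edgesIn G (I₁ △ I₂) ≤ s * ∣ I₁ △ I₂ ∣) →
    Σ (Subset n) (λ T → HittingSet G T × n ^ ∣ T ∣ ≤ 2 ^ (5 * s * n))
  main n N≤n G (_ , (I₀ , max₀ , refl) , a≡cn) sparse
    with ⌊log₂⌋-exists n (≤-trans (m^n>0 2 (2 * q + 40)) N≤n)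
  ... | l , 2^l≤n , n<2^[1+l] = finish
        (grow-dyadic G max₀ 1≤s sparse L q 5q≤4L (denominator-bound c c>0 ∣ I₀ ∣ n a≡cn) m)
    where
    open ≤-Reasoning
    -- Running l - 3 dyadic blocks keeps 2^m at most n/8, while L = l + 1 exceeds log n, so |T| ≤
    -- 5sn / L suffices.
    m = l ∸ 3
    L = 4 + m
    D = 5 * s * n / L

    instance
      n≢0 : NonZero n
      n≢0 = >-nonZero (≤-trans (m^n>0 2 l) 2^l≤n)

    2q+40≤l : 2 * q + 40 ≤ l
    2q+40≤l = ≮⇒≥ λ l< → <⇒≱ n<2^[1+l] (≤-trans (^-monoʳ-≤ 2 l<) N≤n)

    3+m≡l : 3 + m ≡ l
    3+m≡l = m+[n∸m]≡n (≤-trans (≤-trans (m≤m+n 3 37) (m≤n+m 40 (2 * q))) 2q+40≤l)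

    2q+37≤m : 2 * q + 37 ≤ m
    2q+37≤m = +-cancelˡ-≤ 3 _ _ (begin
      3 + (2 * q + 37)  ≡⟨ +-comm 3 (2 * q + 37) ⟩
      2 * q + 37 + 3    ≡⟨ +-assoc (2 * q) 37 3 ⟩
      2 * q + 40        ≤⟨ 2q+40≤l ⟩
      l                 ≡⟨ 3+m≡l ⟨
      3 + m             ∎)

    5q≤4L : 5 * q ≤ 4 * L
    5q≤4L = begin
      5 * q        ≤⟨ *-monoˡ-≤ q (m≤m+n 5 3) ⟩
      8 * q        ≡⟨ *-assoc 4 2 q ⟩
      4 * (2 * q)  ≤⟨ *-monoʳ-≤ 4 (≤-trans (≤-trans (m≤m+n (2 * q) 37) 2q+37≤m) (m≤n+m m 4)) ⟩
      4 * L        ∎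

    8*2^m≤n : 8 * 2 ^ m ≤ n
    8*2^m≤n = begin
      8 * 2 ^ m    ≡⟨ ^-distribˡ-+-* 2 3 m ⟨
      2 ^ (3 + m)  ≡⟨ cong (2 ^_) 3+m≡l ⟩
      2 ^ l        ≤⟨ 2^l≤n ⟩
      n            ∎

    finish : SmallHitting G D
      ⊎ ∃[ w ] (Reached G max₀ 1≤s sparse (2 ^ m) w × 5 * n * m ≤ 4 * L * (w + 2 ^ m)) →
      Σ (Subset n) (λ T → HittingSet G T × n ^ ∣ T ∣ ≤ 2 ^ (5 * s * n))
    finish (inj₁ (T , hits , small)) = T , hits , (begin
      n ^ ∣ T ∣           ≤⟨ ^-monoˡ-≤ ∣ T ∣ (<⇒≤ n<2^[1+l]) ⟩
      (2 ^ suc l) ^ ∣ T ∣ ≡⟨ ^-*-assoc 2 (suc l) ∣ T ∣ ⟩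
      2 ^ (suc l * ∣ T ∣) ≡⟨ cong (λ k → 2 ^ (suc k * ∣ T ∣)) 3+m≡l ⟨
      2 ^ (L * ∣ T ∣)     ≤⟨ ^-monoʳ-≤ 2 (*-monoʳ-≤ L small) ⟩
      2 ^ (L * D)         ≡⟨ cong (2 ^_) (*-comm L D) ⟩
      2 ^ (D * L)         ≤⟨ ^-monoʳ-≤ 2 (m/n*n≤m (5 * s * n) L) ⟩
      2 ^ (5 * s * n)     ∎)
    -- If no block stopped, W would have to contain more than n vertices.
    finish (inj₂ (w , (W , w≤W , _) , bound)) = contradiction bound
      (growth-exceeds-n n m (2 ^ m) w 8*2^m≤n (≤-trans w≤W (∣p∣≤n W))
        (≤-trans (m≤n+m 37 (2 * q)) 2q+37≤m))
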